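{- Let $k$ be a field of characteristic zero and let $S=\{z^d+c : d\geq2,\ c\in k^*\}\subset k[z]$, where $d$ ranges over the integers $\ge 2$ and $c$ over the nonzero elements of $k$. Then the semigroup generated by $S$ under composition is free.
   Context: Free means free on the generating set $S$: whenever $\theta_1\circ\cdots\circ\theta_r=\tau_1\circ\cdots\circ\tau_k$ as polynomials, with $r,k\ge1$ and $\theta_i,\tau_j\in S$, one has $r=k$ and $\theta_i=\tau_i$ for all $1\le i\le r$. -}

module Defs where

open import Algebra.Apartness.Bundles using (HeytingField; HeytingCommutativeRing)
open import Algebra.Bundles using (CommutativeRing)
import Algebra.Definitions.RawMonoid as RawMonoidDefs
open import Data.List.Base using (List; []; _∷_; map)
open import Data.List.NonEmpty.Base using (List⁺; toList; foldr₁)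
open import Data.List.NonEmpty.Relation.Unary.All using (All)
open import Data.List.Relation.Binary.Pointwise.Base using (Pointwise)
open import Data.Nat.Base using (ℕ; zero; suc; _≤_)
open import Data.Product.Base using (∃-syntax; _×_)
open import Level using (_⊔_)
open import Relation.Binary.Core using (Rel)
open import Relation.Nullary.Negation.Core using (¬_)
open import Relation.Unary using (Pred)

-- Fields are Heyting fields.  Decidability of _≈_ is not assumed; a field with
-- decidable equality is the special case in which x # y means ¬ (x ≈ y).

CharacteristicZero : ∀ {c ℓ₁ ℓ₂} → HeytingField c ℓ₁ ℓ₂ → Set ℓ₁
CharacteristicZero K = ∀ n → ¬ (suc n · 1# ≈ 0#)
  where
  open HeytingField K using (_≈_; 0#; 1#; heytingCommutativeRing)
  open CommutativeRing (HeytingCommutativeRing.commutativeRing heytingCommutativeRing)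
    using (+-rawMonoid)
  open RawMonoidDefs +-rawMonoid renaming (_×_ to _·_) using ()

module Polynomials {c ℓ₁ ℓ₂} (K : HeytingField c ℓ₁ ℓ₂) where

  open HeytingField K using (Carrier; _≈_; _+_; _*_; 0#; 1#)

  -- Coefficients in increasing order of degree; trailing zeros are allowed, so
  -- equality of polynomials is _≋_ below, not propositional equality of lists.
  Poly : Set c
  Poly = List Carrier

  coeff : Poly → ℕ → Carrier
  coeff []      _       = 0#
  coeff (a ∷ p) zero    = a
  coeff (a ∷ p) (suc n) = coeff p n

  infix 4 _≋_

  _≋_ : Rel Poly ℓ₁
  p ≋ q = ∀ n → coeff p n ≈ coeff q n

  const : Carrier → Poly
  const a = a ∷ []

  z : Poly
  z = 0# ∷ 1# ∷ []

  infixl 6 _⊕_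
  infixl 7 _⊗_
  infixr 8 _^_
  infixr 9 _∘_

  _⊕_ : Poly → Poly → Poly
  []      ⊕ q       = q
  (a ∷ p) ⊕ []      = a ∷ p
  (a ∷ p) ⊕ (b ∷ q) = (a + b) ∷ (p ⊕ q)

  _⊗_ : Poly → Poly → Poly
  []      ⊗ q = []
  (a ∷ p) ⊗ q = map (a *_) q ⊕ (0# ∷ (p ⊗ q))

  _^_ : Poly → ℕ → Poly
  p ^ zero  = const 1#
  p ^ suc n = p ⊗ (p ^ n)

  -- p ∘ q = p(q(z)), by Horner's rule.
  _∘_ : Poly → Poly → Poly
  []      ∘ q = []
  (a ∷ p) ∘ q = const a ⊕ q ⊗ (p ∘ q)

  -- The set { z^d + a : d ≥ 2, a ≠ 0 }, closed under _≋_.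
  S : Pred Poly (c ⊔ ℓ₁)
  S θ = ∃[ d ] ∃[ a ] (2 ≤ d × ¬ (a ≈ 0#) × θ ≋ z ^ d ⊕ const a)

  -- The semigroup generated by G under composition is free on G: two nonempty
  -- words in G with the same composite agree letter by letter.  Pointwise
  -- includes equality of the lengths.
  FreeOn : ∀ {p} → Pred Poly p → Set (c ⊔ ℓ₁ ⊔ p)
  FreeOn G = (θs τs : List⁺ Poly) → All G θs → All G τs →
             foldr₁ _∘_ θs ≋ foldr₁ _∘_ τs →
             Pointwise _≋_ (toList θs) (toList τs)

{-# OPTIONS --safe #-}
-- The composite of a word whose innermost letter is z^d + a has the form
-- z^(kd) (z^d + (k+1) a) + (terms of degree < kd): composing on the left with
-- z^e + b multiplies k+1 by e ≥ 2, and the summand b lies below degree kd.  In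
-- characteristic zero (k+1) a ≠ 0, so d and a can be read off the composite.  The
-- innermost letter is monic of positive degree, hence it can be cancelled on
-- the right, and the remaining letters are compared in the same way.
module Submission where

open import Defs
open import Algebra.Apartness.Bundles using (HeytingField; HeytingCommutativeRing)
open import Algebra.Bundles using (CommutativeRing)
import Algebra.Properties.CommutativeSemigroup as CommutativeSemigroupProperties
import Algebra.Properties.Ring as RingProperties
import Algebra.Properties.Semiring.Mult as SemiringMult
open import Data.Empty using (⊥-elim)
open import Data.List.Base using (List; []; _∷_; _∷ʳ_; map; foldr; length)
open import Data.List.NonEmpty.Base using (_∷_; foldr₁)
open import Data.List.NonEmpty.Relation.Unary.All using (_∷_)
open import Data.List.Properties using (foldr-∷ʳ)
open import Data.List.Relation.Binary.Pointwise as Pointwise using (Pointwise; []; _∷_)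
open import Data.List.Relation.Unary.All as All using ([]; _∷_)
open import Data.List.Reverse using (Reverse; reverseView; []; _∶_∶ʳ_)
open import Data.Nat.Base as ℕ using (ℕ; zero; suc; s≤s; z≤n)
import Data.Nat.Properties as ℕ
open import Data.Nat.Solver using (module +-*-Solver)
open import Data.Product.Base using (∃-syntax; _×_; _,_; proj₁; proj₂)
open import Level using (_⊔_)
open import Relation.Binary.Definitions using (tri<; tri≈; tri>)
open import Relation.Binary.PropositionalEquality as ≡ using (_≡_)
import Relation.Binary.Reasoning.Setoid as SetoidReasoning
open import Relation.Nullary.Negation.Core using (¬_)

module Words {c ℓ₁ ℓ₂} (K : HeytingField c ℓ₁ ℓ₂) where

  open HeytingField K using (heytingCommutativeRing; _#_; tight; #⇒invertible)
  open CommutativeRing (HeytingCommutativeRing.commutativeRing heytingCommutativeRing)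
  open CommutativeSemigroupProperties +-commutativeSemigroup using (interchange)
  open CommutativeSemigroupProperties *-commutativeSemigroup using (x∙yz≈y∙xz)
  open RingProperties ring using (+-cancelˡ; +-cancelʳ; x≈y⇒x∙y⁻¹≈ε; x[y-z]≈xy-xz)
  open SemiringMult semiring using (×-congʳ; ×-homo-+; ×-homo-1; ×-assoc-*)
    renaming (_×_ to _·_)
  open Polynomials K
  open SetoidReasoning setoid

  -- Coefficient sequences and their Cauchy product.

  Seq : Set c
  Seq = ℕ → Carrier

  infix 4 _≐_

  _≐_ : Seq → Seq → Set ℓ₁
  f ≐ g = ∀ n → f n ≈ g n

  -- The Cauchy product, split in the same way as `_⊗_`: the lowest coefficient of the left factor
  -- is peeled off and the rest shifted.
  conv : Seq → Seq → Seq
  conv f g zero    = f 0 * g 0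
  conv f g (suc n) = f 0 * g (suc n) + conv (λ i → f (suc i)) g n

  conv-cong : ∀ {f f′ g g′} → f ≐ f′ → g ≐ g′ → conv f g ≐ conv f′ g′
  conv-cong p q zero    = *-cong (p 0) (q 0)
  conv-cong p q (suc n) =
    +-cong (*-cong (p 0) (q (suc n))) (conv-cong (λ i → p (suc i)) q n)

  conv-zeroˡ : ∀ {f} g → (∀ n → f n ≈ 0#) → ∀ n → conv f g n ≈ 0#
  conv-zeroˡ g p zero    = trans (*-congʳ (p 0)) (zeroˡ _)
  conv-zeroˡ g p (suc n) =
    trans (+-cong (trans (*-congʳ (p 0)) (zeroˡ _)) (conv-zeroˡ g (λ i → p (suc i)) n))
          (+-identityˡ 0#)

  conv-zeroʳ : ∀ f {g} → (∀ n → g n ≈ 0#) → ∀ n → conv f g n ≈ 0#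
  conv-zeroʳ f q zero    = trans (*-congˡ (q 0)) (zeroʳ _)
  conv-zeroʳ f q (suc n) =
    trans (+-cong (trans (*-congˡ (q (suc n))) (zeroʳ _)) (conv-zeroʳ _ q n))
          (+-identityˡ 0#)

  conv-+ˡ : ∀ f f′ g → conv (λ n → f n + f′ n) g ≐ λ n → conv f g n + conv f′ g n
  conv-+ˡ f f′ g zero    = distribʳ _ _ _
  conv-+ˡ f f′ g (suc n) =
    trans (+-cong (distribʳ _ _ _) (conv-+ˡ _ _ g n)) (interchange _ _ _ _)

  conv-+ʳ : ∀ f g g′ → conv f (λ n → g n + g′ n) ≐ λ n → conv f g n + conv f g′ n
  conv-+ʳ f g g′ zero    = distribˡ _ _ _
  conv-+ʳ f g g′ (suc n) =
    trans (+-cong (distribˡ _ _ _) (conv-+ʳ _ g g′ n)) (interchange _ _ _ _)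

  conv-*ˡ : ∀ a f g → conv (λ n → a * f n) g ≐ λ n → a * conv f g n
  conv-*ˡ a f g zero    = *-assoc _ _ _
  conv-*ˡ a f g (suc n) =
    trans (+-cong (*-assoc _ _ _) (conv-*ˡ a _ g n)) (sym (distribˡ _ _ _))

  conv-*ʳ : ∀ a f g → conv f (λ n → a * g n) ≐ λ n → a * conv f g n
  conv-*ʳ a f g zero    = x∙yz≈y∙xz _ _ _
  conv-*ʳ a f g (suc n) =
    trans (+-cong (x∙yz≈y∙xz _ _ _) (conv-*ʳ a _ g n)) (sym (distribˡ _ _ _))

  conv-assoc : ∀ f g h → conv (conv f g) h ≐ conv f (conv g h)
  conv-assoc f g h zero    = *-assoc _ _ _
  conv-assoc f g h (suc n) = begin
    -- The tail of `conv f g` unfolds to a multiple of the tail of `g` plus `conv f⁺ g`, so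
    -- linearity and the induction hypothesis apply.
    f 0 * g 0 * h (suc n) + conv (λ i → f 0 * g (suc i) + conv f⁺ g i) h n
      ≈⟨ +-cong (*-assoc _ _ _) (conv-+ˡ _ _ h n) ⟩
    f 0 * (g 0 * h (suc n)) + (conv (λ i → f 0 * g (suc i)) h n + conv (conv f⁺ g) h n)
      ≈⟨ +-congˡ (+-cong (conv-*ˡ _ _ h n) (conv-assoc f⁺ g h n)) ⟩
    f 0 * (g 0 * h (suc n)) + (f 0 * conv (λ i → g (suc i)) h n + conv f⁺ (conv g h) n)
      ≈⟨ +-assoc _ _ _ ⟨
    f 0 * (g 0 * h (suc n)) + f 0 * conv (λ i → g (suc i)) h n + conv f⁺ (conv g h) n
      ≈⟨ +-congʳ (distribˡ _ _ _) ⟨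
    f 0 * conv g h (suc n) + conv f⁺ (conv g h) n ∎
    where f⁺ = λ i → f (suc i)

  conv-constˡ : ∀ a g → conv (coeff (const a)) g ≐ λ n → a * g n
  conv-constˡ a g zero    = refl
  conv-constˡ a g (suc n) =
    trans (+-congˡ (conv-zeroˡ g (λ _ → refl) n)) (+-identityʳ _)

  conv-identityˡ : ∀ g → conv (coeff (const 1#)) g ≐ g
  conv-identityˡ g n = trans (conv-constˡ 1# g n) (*-identityˡ _)

  conv-identityʳ : ∀ f → conv f (coeff (const 1#)) ≐ f
  conv-identityʳ f zero    = *-identityʳ _
  conv-identityʳ f (suc n) =
    trans (+-cong (zeroʳ _) (conv-identityʳ _ n)) (+-identityˡ _)

  conv-shiftˡ : ∀ {f} g → f 0 ≈ 0# → ∀ n → conv f g (suc n) ≈ conv (λ i → f (suc i)) g n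
  conv-shiftˡ g p n =
    trans (+-congʳ (trans (*-congʳ p) (zeroˡ _))) (+-identityˡ _)

  -- Coefficients of the operations on polynomials

  coeff-⊕ : ∀ p q → coeff (p ⊕ q) ≐ λ n → coeff p n + coeff q n
  coeff-⊕ []      q       n       = sym (+-identityˡ _)
  coeff-⊕ (a ∷ p) []      n       = sym (+-identityʳ _)
  coeff-⊕ (a ∷ p) (b ∷ q) zero    = refl
  coeff-⊕ (a ∷ p) (b ∷ q) (suc n) = coeff-⊕ p q n

  coeff-map : ∀ a p → coeff (map (a *_) p) ≐ λ n → a * coeff p n
  coeff-map a []      n       = sym (zeroʳ a)
  coeff-map a (b ∷ p) zero    = refl
  coeff-map a (b ∷ p) (suc n) = coeff-map a p n

  coeff-⊗ : ∀ p q → coeff (p ⊗ q) ≐ conv (coeff p) (coeff q)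
  coeff-⊗ []      q n       = sym (conv-zeroˡ (coeff q) (λ _ → refl) n)
  coeff-⊗ (a ∷ p) q zero    =
    trans (coeff-⊕ (map (a *_) q) _ 0) (trans (+-identityʳ _) (coeff-map a q 0))
  coeff-⊗ (a ∷ p) q (suc n) =
    trans (coeff-⊕ (map (a *_) q) _ (suc n)) (+-cong (coeff-map a q (suc n)) (coeff-⊗ p q n))

  coeff-const⊕⊗ : ∀ a p q → coeff (const a ⊕ p ⊗ q) ≐
                            λ n → coeff (const a) n + conv (coeff p) (coeff q) n
  coeff-const⊕⊗ a p q n = trans (coeff-⊕ (const a) (p ⊗ q) n) (+-congˡ (coeff-⊗ p q n))

  coeff-beyond : ∀ p j → coeff p (length p ℕ.+ j) ≈ 0#
  coeff-beyond []      j = refl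
  coeff-beyond (a ∷ p) j = coeff-beyond p j

  -- Unlike _≋_, which unfolds to a function type, _≃_ lets Agda infer the
  -- polynomials from a proof of their equality.
  infix 4 _≃_

  record _≃_ (p q : Poly) : Set ℓ₁ where
    constructor pointwise
    field at : p ≋ q

  open _≃_

  ≃-refl : ∀ {p} → p ≃ p
  ≃-refl = pointwise λ _ → refl

  ≃-sym : ∀ {p q} → p ≃ q → q ≃ p
  ≃-sym e = pointwise λ n → sym (at e n)

  ≃-trans : ∀ {p q r} → p ≃ q → q ≃ r → p ≃ r
  ≃-trans e e′ = pointwise λ n → trans (at e n) (at e′ n)

  const-cong : ∀ {a b} → a ≈ b → const a ≃ const b
  const-cong a≈b = pointwise λ { zero → a≈b ; (suc _) → refl }

  const-0# : const 0# ≃ []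
  const-0# = pointwise λ { zero → refl ; (suc _) → refl }

  const-+ : ∀ a b → coeff (const (a + b)) ≐ λ n → coeff (const a) n + coeff (const b) n
  const-+ a b zero    = refl
  const-+ a b (suc n) = sym (+-identityˡ _)

  ∷-cong : ∀ {a b p q} → a ≈ b → p ≃ q → a ∷ p ≃ b ∷ q
  ∷-cong a≈b p≃q = pointwise λ { zero → a≈b ; (suc n) → at p≃q n }

  ∷≃[] : ∀ {a p} → a ≈ 0# → p ≃ [] → a ∷ p ≃ []
  ∷≃[] a≈0 p≃[] = pointwise λ { zero → a≈0 ; (suc n) → at p≃[] n }

  tail-≃ : ∀ {a b p q} → a ∷ p ≃ b ∷ q → p ≃ q
  tail-≃ e = pointwise λ n → at e (suc n)

  tail-≃[] : ∀ {a p} → a ∷ p ≃ [] → p ≃ []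
  tail-≃[] e = pointwise λ n → at e (suc n)

  ⊕-cong : ∀ {p p′ q q′} → p ≃ p′ → q ≃ q′ → p ⊕ q ≃ p′ ⊕ q′
  ⊕-cong {p} {p′} {q} {q′} e e′ = pointwise λ n →
    trans (coeff-⊕ p q n) (trans (+-cong (at e n) (at e′ n)) (sym (coeff-⊕ p′ q′ n)))

  ⊗-cong : ∀ {p p′ q q′} → p ≃ p′ → q ≃ q′ → p ⊗ q ≃ p′ ⊗ q′
  ⊗-cong {p} {p′} {q} {q′} e e′ = pointwise λ n →
    trans (coeff-⊗ p q n) (trans (conv-cong (at e) (at e′) n) (sym (coeff-⊗ p′ q′ n)))

  ^-cong : ∀ {p q} → p ≃ q → ∀ n → p ^ n ≃ q ^ n
  ^-cong e zero    = ≃-refl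
  ^-cong e (suc n) = ⊗-cong e (^-cong e n)

  ^-1 : ∀ p → p ^ 1 ≃ p
  ^-1 p = pointwise λ n → trans (coeff-⊗ p (const 1#) n) (conv-identityʳ (coeff p) n)

  -- Composition is a homomorphism in its left argument

  -- Horner's rule recurses on the list, so trailing zeros do not vanish by computation. `∘-congˡ`
  -- needs this case when equal polynomials have lists of different lengths.
  ∘-zeroˡ : ∀ {p} r → p ≃ [] → p ∘ r ≃ []
  ∘-zeroˡ {[]}    r e = ≃-refl
  ∘-zeroˡ {a ∷ p} r e = pointwise λ n → begin
    coeff (const a ⊕ r ⊗ (p ∘ r)) n
      ≈⟨ coeff-const⊕⊗ a r (p ∘ r) n ⟩
    coeff (const a) n + conv (coeff r) (coeff (p ∘ r)) n
      ≈⟨ +-cong (at (∷≃[] (at e 0) ≃-refl) n)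
                (conv-zeroʳ (coeff r) (at (∘-zeroˡ r (tail-≃[] e))) n) ⟩
    0# + 0#
      ≈⟨ +-identityˡ 0# ⟩
    0# ∎

  ∘-congˡ : ∀ {p q} r → p ≃ q → p ∘ r ≃ q ∘ r
  ∘-congˡ {[]}    {q}     r e = ≃-sym (∘-zeroˡ r (≃-sym e))
  ∘-congˡ {a ∷ p} {[]}    r e = ∘-zeroˡ r e
  ∘-congˡ {a ∷ p} {b ∷ q} r e =
    ⊕-cong (const-cong (at e 0)) (⊗-cong (≃-refl {r}) (∘-congˡ r (tail-≃ e)))

  map-∘ : ∀ a p r → map (a *_) p ∘ r ≋ map (a *_) (p ∘ r)
  map-∘ a []      r n = refl
  map-∘ a (b ∷ p) r n = begin
    coeff (const (a * b) ⊕ r ⊗ (map (a *_) p ∘ r)) n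
      ≈⟨ coeff-const⊕⊗ (a * b) r (map (a *_) p ∘ r) n ⟩
    coeff (const (a * b)) n + conv (coeff r) (coeff (map (a *_) p ∘ r)) n
      ≈⟨ +-cong (coeff-map a (const b) n)
                (conv-cong (λ _ → refl) (λ i → trans (map-∘ a p r i) (coeff-map a (p ∘ r) i)) n) ⟩
    a * coeff (const b) n + conv (coeff r) (λ i → a * coeff (p ∘ r) i) n
      ≈⟨ +-congˡ (conv-*ʳ a (coeff r) _ n) ⟩
    a * coeff (const b) n + a * conv (coeff r) (coeff (p ∘ r)) n
      ≈⟨ distribˡ _ _ _ ⟨
    a * (coeff (const b) n + conv (coeff r) (coeff (p ∘ r)) n)
      ≈⟨ *-congˡ (coeff-const⊕⊗ b r (p ∘ r) n) ⟨
    a * coeff ((b ∷ p) ∘ r) n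
      ≈⟨ coeff-map a ((b ∷ p) ∘ r) n ⟨
    coeff (map (a *_) ((b ∷ p) ∘ r)) n ∎

  ⊕-∘ : ∀ p q r → (p ⊕ q) ∘ r ≋ p ∘ r ⊕ q ∘ r
  ⊕-∘ []      q       r n = refl
  ⊕-∘ (a ∷ p) []      r n = sym (trans (coeff-⊕ ((a ∷ p) ∘ r) [] n) (+-identityʳ _))
  ⊕-∘ (a ∷ p) (b ∷ q) r n = begin
    coeff (const (a + b) ⊕ r ⊗ ((p ⊕ q) ∘ r)) n
      ≈⟨ coeff-const⊕⊗ (a + b) r ((p ⊕ q) ∘ r) n ⟩
    coeff (const (a + b)) n + conv (coeff r) (coeff ((p ⊕ q) ∘ r)) n
      ≈⟨ +-cong (const-+ a b n)
                (conv-cong (λ _ → refl) (λ i → trans (⊕-∘ p q r i) (coeff-⊕ (p ∘ r) (q ∘ r) i)) n) ⟩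
    coeff (const a) n + coeff (const b) n
      + conv (coeff r) (λ i → coeff (p ∘ r) i + coeff (q ∘ r) i) n
      ≈⟨ +-congˡ (conv-+ʳ (coeff r) _ _ n) ⟩
    coeff (const a) n + coeff (const b) n
      + (conv (coeff r) (coeff (p ∘ r)) n + conv (coeff r) (coeff (q ∘ r)) n)
      ≈⟨ interchange _ _ _ _ ⟩
    coeff (const a) n + conv (coeff r) (coeff (p ∘ r)) n
      + (coeff (const b) n + conv (coeff r) (coeff (q ∘ r)) n)
      ≈⟨ +-cong (coeff-const⊕⊗ a r (p ∘ r) n) (coeff-const⊕⊗ b r (q ∘ r) n) ⟨
    coeff ((a ∷ p) ∘ r) n + coeff ((b ∷ q) ∘ r) n
      ≈⟨ coeff-⊕ ((a ∷ p) ∘ r) ((b ∷ q) ∘ r) n ⟨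
    coeff ((a ∷ p) ∘ r ⊕ (b ∷ q) ∘ r) n ∎

  -- Induction on `p`: the summand `map (a *_) q` is handled by linearity, and in the shifted
  -- summand associativity of `conv` regroups r(PQ) as (rP)Q.
  ⊗-∘ : ∀ p q r → (p ⊗ q) ∘ r ≋ (p ∘ r) ⊗ (q ∘ r)
  ⊗-∘ []      q r n = refl
  ⊗-∘ (a ∷ p) q r n = begin
    coeff ((map (a *_) q ⊕ (0# ∷ (p ⊗ q))) ∘ r) n
      ≈⟨ ⊕-∘ (map (a *_) q) (0# ∷ (p ⊗ q)) r n ⟩
    coeff (map (a *_) q ∘ r ⊕ (0# ∷ (p ⊗ q)) ∘ r) n
      ≈⟨ coeff-⊕ (map (a *_) q ∘ r) _ n ⟩
    coeff (map (a *_) q ∘ r) n + coeff (const 0# ⊕ r ⊗ ((p ⊗ q) ∘ r)) n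
      ≈⟨ +-cong (trans (map-∘ a q r n) (coeff-map a (q ∘ r) n))
                (trans (coeff-const⊕⊗ 0# r ((p ⊗ q) ∘ r) n)
                       (trans (+-congʳ (at const-0# n)) (+-identityˡ _))) ⟩
    a * coeff (q ∘ r) n + conv (coeff r) (coeff ((p ⊗ q) ∘ r)) n
      ≈⟨ +-cong (sym (conv-constˡ a _ n))
                (conv-cong (λ _ → refl) (λ i → trans (⊗-∘ p q r i) (coeff-⊗ (p ∘ r) (q ∘ r) i)) n) ⟩
    conv (coeff (const a)) (coeff (q ∘ r)) n
      + conv (coeff r) (conv (coeff (p ∘ r)) (coeff (q ∘ r))) n
      ≈⟨ +-congˡ (conv-assoc (coeff r) (coeff (p ∘ r)) (coeff (q ∘ r)) n) ⟨
    conv (coeff (const a)) (coeff (q ∘ r)) n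
      + conv (conv (coeff r) (coeff (p ∘ r))) (coeff (q ∘ r)) n
      ≈⟨ conv-+ˡ (coeff (const a)) _ (coeff (q ∘ r)) n ⟨
    conv (λ i → coeff (const a) i + conv (coeff r) (coeff (p ∘ r)) i) (coeff (q ∘ r)) n
      ≈⟨ conv-cong (coeff-const⊕⊗ a r (p ∘ r)) (λ _ → refl) n ⟨
    conv (coeff ((a ∷ p) ∘ r)) (coeff (q ∘ r)) n
      ≈⟨ coeff-⊗ ((a ∷ p) ∘ r) (q ∘ r) n ⟨
    coeff (((a ∷ p) ∘ r) ⊗ (q ∘ r)) n ∎

  const-∘ : ∀ a r → const a ∘ r ≃ const a
  const-∘ a r = pointwise λ n → trans (coeff-const⊕⊗ a r [] n)
    (trans (+-congˡ (conv-zeroʳ (coeff r) (λ _ → refl) n)) (+-identityʳ _))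

  z-∘ : ∀ r → z ∘ r ≃ r
  z-∘ r = pointwise λ n → begin
    coeff (const 0# ⊕ r ⊗ (const 1# ∘ r)) n
      ≈⟨ coeff-const⊕⊗ 0# r (const 1# ∘ r) n ⟩
    coeff (const 0#) n + conv (coeff r) (coeff (const 1# ∘ r)) n
      ≈⟨ +-cong (at const-0# n) (conv-cong (λ _ → refl) (at (const-∘ 1# r)) n) ⟩
    0# + conv (coeff r) (coeff (const 1#)) n
      ≈⟨ trans (+-identityˡ _) (conv-identityʳ (coeff r) n) ⟩
    coeff r n ∎

  ^-∘ : ∀ p r n → (p ^ n) ∘ r ≃ (p ∘ r) ^ n
  ^-∘ p r zero    = const-∘ 1# r
  ^-∘ p r (suc n) =
    ≃-trans (pointwise (⊗-∘ p (p ^ n) r)) (⊗-cong (≃-refl {p ∘ r}) (^-∘ p r n))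

  ^⊕const-∘ : ∀ p d a r → (p ^ d ⊕ const a) ∘ r ≃ (p ∘ r) ^ d ⊕ const a
  ^⊕const-∘ p d a r =
    ≃-trans (pointwise (⊕-∘ (p ^ d) (const a) r)) (⊕-cong (^-∘ p r d) (const-∘ a r))

  -- Cancelling a monic polynomial of positive degree on the right

  -- Since `f` has leading term 1 at `d`, the coefficient of the product at d + k is the entry at
  -- `k` plus terms in later entries, where `g` and `h` agree. The induction removes those terms one
  -- at a time by dropping the lowest entry of `f`.
  conv-cancelˡ : ∀ d f {g h} k → (∀ j → f (d ℕ.+ j) ≈ coeff (const 1#) j) →
                 (∀ j → g (suc (k ℕ.+ j)) ≈ h (suc (k ℕ.+ j))) →
                 conv f g (d ℕ.+ k) ≈ conv f h (d ℕ.+ k) → g k ≈ h k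
  conv-cancelˡ zero f {g} {h} k top above e = begin
    g k                          ≈⟨ conv-identityˡ g k ⟨
    conv (coeff (const 1#)) g k  ≈⟨ conv-cong top (λ _ → refl) k ⟨
    conv f g k                   ≈⟨ e ⟩
    conv f h k                   ≈⟨ conv-cong top (λ _ → refl) k ⟩
    conv (coeff (const 1#)) h k  ≈⟨ conv-identityˡ h k ⟩
    h k                          ∎
  conv-cancelˡ (suc d) f {g} {h} k top above e =
    conv-cancelˡ d _ k top above
      (+-cancelˡ _ _ _ (trans (+-congʳ (*-congˡ (sym g≈h))) e))
    where
    g≈h : g (suc (d ℕ.+ k)) ≈ h (suc (d ℕ.+ k))
    g≈h = ≡.subst (λ i → g (suc i) ≈ h (suc i)) (ℕ.+-comm k d) (above d)

  -- Descending induction on the bound `m` from which `g` and `h` agree. As `f` has positive degree,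
  -- only coefficients of the products at positive indices are compared, so a discrepancy in the
  -- constant terms does no harm.
  conv-injectiveʳ : ∀ d f {g h} → (∀ j → f (suc d ℕ.+ j) ≈ coeff (const 1#) j) →
                    (∀ n → conv f g (suc n) ≈ conv f h (suc n)) →
                    ∀ m → (∀ j → g (m ℕ.+ j) ≈ h (m ℕ.+ j)) → g ≐ h
  conv-injectiveʳ d f top e zero    agree = agree
  conv-injectiveʳ d f {g} {h} top e (suc m) agree =
    conv-injectiveʳ d f top e m agree′
    where
    agree′ : ∀ j → g (m ℕ.+ j) ≈ h (m ℕ.+ j)
    agree′ zero    = ≡.subst (λ i → g i ≈ h i) (≡.sym (ℕ.+-identityʳ m))
      (conv-cancelˡ (suc d) f m top agree (e (d ℕ.+ m)))
    agree′ (suc j) = ≡.subst (λ i → g i ≈ h i) (≡.sym (ℕ.+-suc m j)) (agree j)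

  -- Comparison with the coefficients of the constant 1 fixes the leading coefficient and makes the
  -- higher ones vanish in a single equation.
  record Monic (d : ℕ) (p : Poly) : Set ℓ₁ where
    constructor monic
    field top : ∀ j → coeff p (d ℕ.+ j) ≈ coeff (const 1#) j

  open Monic

  -- Inverts one step of Horner's rule. The constants enter only coefficient 0, so the positive
  -- coefficients already determine the cofactor; coefficient 0 then gives the constant.
  const⊕⊗-injective : ∀ d {r a b} p q → Monic (suc d) r →
                      const a ⊕ r ⊗ p ≃ const b ⊕ r ⊗ q → a ≈ b × p ≃ q
  const⊕⊗-injective d {r} {a} {b} p q r-monic e = a≈b , pointwise p≋q
    where
    e′ : ∀ n → coeff (const a) n + conv (coeff r) (coeff p) n
             ≈ coeff (const b) n + conv (coeff r) (coeff q) n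
    e′ n = trans (sym (coeff-const⊕⊗ a r p n)) (trans (at e n) (coeff-const⊕⊗ b r q n))

    -- Past the sum of the lengths both lists have only zeros, which starts the descending
    -- induction.
    beyond : ∀ j → coeff p (length p ℕ.+ length q ℕ.+ j) ≈ coeff q (length p ℕ.+ length q ℕ.+ j)
    beyond j = trans
      (≡.subst (λ i → coeff p i ≈ 0#)
        (≡.sym (ℕ.+-assoc (length p) (length q) j)) (coeff-beyond p (length q ℕ.+ j)))
      (≡.subst (λ i → 0# ≈ coeff q i)
        (≡.trans (≡.sym (ℕ.+-assoc (length q) (length p) j))
                 (≡.cong (ℕ._+ j) (ℕ.+-comm (length q) (length p))))
        (sym (coeff-beyond q (length p ℕ.+ j))))

    p≋q : p ≋ q
    p≋q = conv-injectiveʳ d (coeff r) (top r-monic) (λ n → +-cancelˡ 0# _ _ (e′ (suc n)))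
            (length p ℕ.+ length q) beyond

    a≈b : a ≈ b
    a≈b = +-cancelʳ _ _ _ (trans (e′ 0) (+-congˡ (*-congˡ (sym (p≋q 0)))))

  -- Horner's rule is undone coefficient by coefficient. A list that ends first is continued as a
  -- zero coefficient followed by `[]`.
  ∘-cancelʳ : ∀ d {r} p q → Monic (suc d) r → p ∘ r ≃ q ∘ r → p ≃ q
  ∘-cancelʳ d {r} p q r-monic = cancel p q
    where
    const-0#⊕ : const 0# ⊕ r ⊗ [] ≃ []
    const-0#⊕ = ∘-zeroˡ r const-0#

    cancel : ∀ p q → p ∘ r ≃ q ∘ r → p ≃ q
    cancel []      []      e = ≃-refl
    cancel []      (b ∷ q) e
      with const⊕⊗-injective d [] (q ∘ r) r-monic (≃-trans const-0#⊕ e)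
    ... | 0≈b , []≃q = ≃-sym (∷≃[] (sym 0≈b) (≃-sym (cancel [] q []≃q)))
    cancel (a ∷ p) []      e
      with const⊕⊗-injective d (p ∘ r) [] r-monic (≃-trans e (≃-sym const-0#⊕))
    ... | a≈0 , p≃[] = ∷≃[] a≈0 (cancel p [] p≃[])
    cancel (a ∷ p) (b ∷ q) e with const⊕⊗-injective d (p ∘ r) (q ∘ r) r-monic e
    ... | a≈b , p≃q = ∷-cong a≈b (cancel p q p≃q)

  -- The leading terms of a composite

  z^ : ∀ d j → coeff (z ^ suc d) (suc j) ≈ coeff (z ^ d) j
  z^ d j = trans (coeff-⊗ z (z ^ d) (suc j))
    (trans (conv-shiftˡ {coeff z} (coeff (z ^ d)) refl j) (conv-identityˡ (coeff (z ^ d)) j))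

  z^-0 : ∀ d → coeff (z ^ suc d) 0 ≈ 0#
  z^-0 d = trans (coeff-⊗ z (z ^ d) 0) (zeroˡ _)

  z^-monic : ∀ d → Monic d (z ^ d)
  z^-monic zero    = monic λ _ → refl
  z^-monic (suc d) = monic λ j → trans (z^ d (d ℕ.+ j)) (top (z^-monic d) j)

  conv-z^ : ∀ d g n → conv (coeff (z ^ d)) g (d ℕ.+ n) ≈ g n
  conv-z^ zero    g n = conv-identityˡ g n
  conv-z^ (suc d) g n = trans (conv-shiftˡ {coeff (z ^ suc d)} g (z^-0 d) (d ℕ.+ n))
    (trans (conv-cong (z^ d) (λ _ → refl) (d ℕ.+ n)) (conv-z^ d g n))

  z^⊕ : ℕ → Carrier → Poly
  z^⊕ d a = z ^ d ⊕ const a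

  z^⊕-cong : ∀ d {a b} → a ≈ b → z^⊕ d a ≃ z^⊕ d b
  z^⊕-cong d a≈b = ⊕-cong ≃-refl (const-cong a≈b)

  z^⊕-monic : ∀ d a → Monic (suc d) (z^⊕ (suc d) a)
  z^⊕-monic d a = monic λ j → trans (coeff-⊕ (z ^ suc d) (const a) (suc d ℕ.+ j))
    (trans (+-identityʳ _) (top (z^-monic (suc d)) j))

  z^⊕-0 : ∀ d a → coeff (z^⊕ (suc d) a) 0 ≈ a
  z^⊕-0 d a = trans (coeff-⊕ (z ^ suc d) (const a) 0) (trans (+-congʳ (z^-0 d)) (+-identityˡ a))

  z^-between : ∀ {i d} → i ℕ.< d → coeff (z ^ d) i ≈ 0#
  z^-between {zero}  {suc d} (s≤s _)   = z^-0 d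
  z^-between {suc i} {suc d} (s≤s i<d) = trans (z^ d i) (z^-between i<d)

  z^⊕-between : ∀ {i d} a → suc i ℕ.< d → coeff (z^⊕ d a) (suc i) ≈ 0#
  z^⊕-between {i} {d} a i<d = trans (coeff-⊕ (z ^ d) (const a) (suc i))
    (trans (+-identityʳ _) (z^-between i<d))

  -- With D = d + 1, the product of z^u (z^D + s) and z^v (z^D + t) is z^(u+v) (z^(2D) + (s+t) z^D +
  -- st). From degree u + v + D on, neither st nor any product with a lower-order remainder is
  -- visible.
  conv-leading : ∀ d {f g s t} u v →
    (∀ j → f (u ℕ.+ j) ≈ coeff (z^⊕ (suc d) s) j) →
    (∀ j → g (v ℕ.+ j) ≈ coeff (z^⊕ (suc d) t) j) →
    ∀ j → conv f g (u ℕ.+ (v ℕ.+ (suc d ℕ.+ j))) ≈ coeff (z^⊕ (suc d) (s + t)) j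
  conv-leading d {f} {g} {s} {t} zero v F G j = begin
    conv f g N
      ≈⟨ conv-cong (λ i → trans (F i) (coeff-⊕ (z ^ suc d) (const s) i)) (λ _ → refl) N ⟩
    conv (λ i → coeff (z ^ suc d) i + coeff (const s) i) g N
      ≈⟨ conv-+ˡ _ _ g N ⟩
    conv (coeff (z ^ suc d)) g N + conv (coeff (const s)) g N
      ≈⟨ +-cong z^-part (conv-constˡ s g N) ⟩
    g (v ℕ.+ j) + s * g N
      -- At index `N` the sequence `g` is 1 for j = 0 and 0 otherwise, so `s` is added to the
      -- constant term only.
      ≈⟨ +-cong (trans (G j) (coeff-⊕ (z ^ suc d) (const t) j))
                (*-congˡ (trans (G (suc d ℕ.+ j)) (top (z^⊕-monic d t) j))) ⟩
    coeff (z ^ suc d) j + coeff (const t) j + s * coeff (const 1#) j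
      ≈⟨ +-assoc _ _ _ ⟩
    coeff (z ^ suc d) j + (coeff (const t) j + s * coeff (const 1#) j)
      ≈⟨ +-congˡ (constants j) ⟩
    coeff (z ^ suc d) j + coeff (const (s + t)) j
      ≈⟨ coeff-⊕ (z ^ suc d) (const (s + t)) j ⟨
    coeff (z^⊕ (suc d) (s + t)) j ∎
    where
    N = v ℕ.+ (suc d ℕ.+ j)

    z^-part : conv (coeff (z ^ suc d)) g N ≈ g (v ℕ.+ j)
    z^-part = ≡.subst (λ i → conv (coeff (z ^ suc d)) g i ≈ g (v ℕ.+ j))
      (solve 3 (λ d v j → d :+ (v :+ j) := v :+ (d :+ j)) ≡.refl (suc d) v j)
      (conv-z^ (suc d) g (v ℕ.+ j))
      where open +-*-Solver

    constants : ∀ j → coeff (const t) j + s * coeff (const 1#) j ≈ coeff (const (s + t)) j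
    constants zero    = trans (+-congˡ (*-identityʳ s)) (+-comm t s)
    constants (suc _) = trans (+-identityˡ _) (zeroʳ s)
  conv-leading d {f} {g} {s} {t} (suc u) v F G j =
    trans (+-cong (trans (*-congˡ g≈0) (zeroʳ _)) (conv-leading d u v F G j)) (+-identityˡ _)
    where
    g≈0 : g (suc (u ℕ.+ (v ℕ.+ (suc d ℕ.+ j)))) ≈ 0#
    -- The index exceeds v + D, the degree of `g`, where D = d + 1.
    g≈0 = ≡.subst (λ i → g i ≈ 0#)
      (solve 4 (λ u v d j → v :+ (con 1 :+ d :+ (con 1 :+ (u :+ j)))
                         := con 1 :+ (u :+ (v :+ (con 1 :+ d :+ j)))) ≡.refl u v d j)
      (trans (G (suc d ℕ.+ suc (u ℕ.+ j))) (top (z^⊕-monic d t) (suc (u ℕ.+ j))))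
      where open +-*-Solver

  -- p = z^(kd) (z^d + (k+1) a) + (terms of degree < kd)
  record Leading (d : ℕ) (a : Carrier) (k : ℕ) (p : Poly) : Set ℓ₁ where
    constructor leading
    field terms : ∀ j → coeff p (k ℕ.* d ℕ.+ j) ≈ coeff (z^⊕ d (suc k · a)) j

  open Leading

  Leading-z^⊕ : ∀ d a → Leading d a 0 (z^⊕ d a)
  Leading-z^⊕ d a = leading (at (z^⊕-cong d (sym (×-homo-1 a))))

  Leading-resp-≃ : ∀ {d a k p q} → p ≃ q → Leading d a k p → Leading d a k q
  Leading-resp-≃ e L = leading λ j → trans (sym (at e _)) (terms L j)

  -- The multiples of `a` add, (k+1) + (l+1) = (k+l+1) + 1, and the shift kD + lD + D supplied by
  -- `conv-leading` is (k+l+1)D, where D = d + 1.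
  Leading-⊗ : ∀ {d a k l p q} → Leading (suc d) a k p → Leading (suc d) a l q →
              Leading (suc d) a (suc (k ℕ.+ l)) (p ⊗ q)
  Leading-⊗ {d} {a} {k} {l} {p} {q} L M = leading λ j → begin
    coeff (p ⊗ q) (suc (k ℕ.+ l) ℕ.* suc d ℕ.+ j)
      ≈⟨ coeff-⊗ p q _ ⟩
    conv (coeff p) (coeff q) (suc (k ℕ.+ l) ℕ.* suc d ℕ.+ j)
      ≡⟨ ≡.cong (conv (coeff p) (coeff q))
           (solve 4 (λ k l d j → (con 1 :+ (k :+ l)) :* d :+ j
                              := k :* d :+ (l :* d :+ (d :+ j))) ≡.refl k l (suc d) j) ⟩
    conv (coeff p) (coeff q) (k ℕ.* suc d ℕ.+ (l ℕ.* suc d ℕ.+ (suc d ℕ.+ j)))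
      ≈⟨ conv-leading d (k ℕ.* suc d) (l ℕ.* suc d) (terms L) (terms M) j ⟩
    coeff (z^⊕ (suc d) (suc k · a + suc l · a)) j
      ≈⟨ at (z^⊕-cong (suc d) (×-homo-+ a (suc k) (suc l))) j ⟨
    coeff (z^⊕ (suc d) ((suc k ℕ.+ suc l) · a)) j
      ≡⟨ ≡.cong (λ i → coeff (z^⊕ (suc d) (suc i · a)) j) (ℕ.+-suc k l) ⟩
    coeff (z^⊕ (suc d) (suc (suc (k ℕ.+ l)) · a)) j ∎
    where open +-*-Solver

  Leading-^ : ∀ {d a k p} → Leading (suc d) a k p → ∀ e →
              ∃[ l ] Leading (suc d) a l (p ^ suc e)
  Leading-^ {p = p} L zero    = _ , Leading-resp-≃ (≃-sym (^-1 p)) L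
  Leading-^         L (suc e) = _ , Leading-⊗ L (proj₂ (Leading-^ L e))

  -- An exponent of at least 2 makes the new shift positive, so `b`, which sits in degree 0, lies
  -- below the range that `Leading` describes.
  Leading-^⊕const : ∀ {d a k p} → Leading (suc d) a k p → ∀ e b →
                    ∃[ l ] Leading (suc d) a l (p ^ suc (suc e) ⊕ const b)
  Leading-^⊕const {k = k} {p} L e b with Leading-^ L e
  ... | l , M = suc (k ℕ.+ l) , leading λ j →
    trans (coeff-⊕ (p ^ suc (suc e)) (const b) _)
          (trans (+-identityʳ _) (terms (Leading-⊗ L M) j))

  Leading-monic : ∀ {d a k p} → Leading (suc d) a k p → Monic (k ℕ.* suc d ℕ.+ suc d) p
  Leading-monic {d} {a} {k} {p} L = monic λ j →
    ≡.subst (λ i → coeff p i ≈ coeff (const 1#) j) (≡.sym (ℕ.+-assoc (k ℕ.* suc d) (suc d) j))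
      (trans (terms L (suc d ℕ.+ j)) (top (z^⊕-monic d (suc k · a)) j))

  -- Reading off the innermost letter

  -- Here `x` is only known to be unequal to zero, not invertible. By tightness it suffices to
  -- refute `a # b`, which would make the difference invertible and force `x` to be zero.
  *-cancelˡ-≉0 : ∀ {x a b} → ¬ (x ≈ 0#) → x * a ≈ x * b → a ≈ b
  *-cancelˡ-≉0 {x} {a} {b} x≉0 e = proj₁ (tight a b) a#b⇒⊥
    where
    a#b⇒⊥ : ¬ (a # b)
    a#b⇒⊥ a#b with #⇒invertible a#b
    ... | y , _ , ab*y≈1 = x≉0 (begin
      x                  ≈⟨ *-identityʳ x ⟨
      x * 1#             ≈⟨ *-congˡ ab*y≈1 ⟨
      x * ((a - b) * y)  ≈⟨ *-assoc _ _ _ ⟨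
      x * (a - b) * y    ≈⟨ *-congʳ (trans (x[y-z]≈xy-xz x a b) (x≈y⇒x∙y⁻¹≈ε e)) ⟩
      0# * y             ≈⟨ zeroˡ y ⟩
      0#                 ∎)

  -- Letters, words and their composites.

  record Letter : Set (c ⊔ ℓ₁) where
    constructor letter
    field
      degree-2   : ℕ
      constant   : Carrier
      constant≉0 : ¬ (constant ≈ 0#)

    -- Storing the degree minus 2 lets `degree` reduce to a double successor, the form in which the
    -- lemmas on `Leading` and `Monic` apply.
    degree-1 degree : ℕ
    degree-1 = suc degree-2
    degree   = suc degree-1

  open Letter

  infixr 5 _◃_

  -- The letter acts by a power and a sum instead of Horner's rule, as `Leading-^⊕const` expects;
  -- `poly-∘` reconciles the two.
  _◃_ : Letter → Poly → Poly
  x ◃ p = p ^ degree x ⊕ const (constant x)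

  -- The empty word yields the identity `z`; stripping letters one by one ends there.
  composite : List Letter → Poly
  composite = foldr _◃_ z

  poly : Letter → Poly
  poly x = x ◃ z

  ◃-∘ : ∀ x p r → (x ◃ p) ∘ r ≃ x ◃ (p ∘ r)
  ◃-∘ x p r = ^⊕const-∘ p (degree x) (constant x) r

  ◃-cong : ∀ x {p q} → p ≃ q → x ◃ p ≃ x ◃ q
  ◃-cong x e = ⊕-cong (^-cong e (degree x)) ≃-refl

  poly-∘ : ∀ x p → poly x ∘ p ≃ x ◃ p
  poly-∘ x p = ≃-trans (◃-∘ x z p) (◃-cong x (z-∘ p))

  -- Exposes the innermost polynomial as a right factor of `_∘_`, ready for `∘-cancelʳ`.
  foldr-◃ : ∀ w r → foldr _◃_ r w ≃ composite w ∘ r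
  foldr-◃ []      r = ≃-sym (z-∘ r)
  foldr-◃ (x ∷ w) r = ≃-trans (◃-cong x (foldr-◃ w r)) (≃-sym (◃-∘ x (composite w) r))

  foldr-◃-cong : ∀ w {p q} → p ≃ q → foldr _◃_ p w ≃ foldr _◃_ q w
  foldr-◃-cong []      e = e
  foldr-◃-cong (x ∷ w) e = ◃-cong x (foldr-◃-cong w e)

  composite-∷ʳ : ∀ w x → composite (w ∷ʳ x) ≃ foldr _◃_ (poly x) w
  composite-∷ʳ w x = ≡.subst (composite (w ∷ʳ x) ≃_) (foldr-∷ʳ _◃_ z x w) ≃-refl

  -- The multiplicity `k` depends on the outer letters; it stays existential, and `Leading-unique`
  -- allows a different one for each word.
  Leading-composite : ∀ w x →
    ∃[ k ] Leading (degree x) (constant x) k (composite (w ∷ʳ x))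
  Leading-composite []      x = 0 , Leading-z^⊕ (degree x) (constant x)
  Leading-composite (y ∷ w) x with Leading-composite w x
  ... | _ , L = Leading-^⊕const L (degree-2 y) (constant y)

  SameLetter : Letter → Letter → Set ℓ₁
  SameLetter x y = degree x ≡ degree y × constant x ≈ constant y

  poly-cong : ∀ {x y} → SameLetter x y → poly x ≃ poly y
  poly-cong (d≡e , a≈b) = ⊕-cong
    (pointwise λ n → reflexive (≡.cong (λ d → coeff (z ^ d) n) d≡e)) (const-cong a≈b)

  -- From members of `S` to letters.

  S⇒Letter : ∀ θ → S θ → Letter
  S⇒Letter _ (suc (suc d) , a , s≤s (s≤s _) , a≉0 , _) = letter d a a≉0

  S⇒poly : ∀ θ (s : S θ) → θ ≃ poly (S⇒Letter θ s)
  S⇒poly _ (suc (suc _) , _ , s≤s (s≤s _) , _ , e) = pointwise e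

  letters : ∀ {θs} → All.All S θs → List Letter
  letters = All.reduce (λ {θ} → S⇒Letter θ)

  foldr₁-composite : ∀ θ {θs} (s : S θ) (ss : All.All S θs) →
                     foldr₁ _∘_ (θ ∷ θs) ≃ composite (letters {θ ∷ θs} (s ∷ ss))
  foldr₁-composite θ          s []       = S⇒poly θ s
  foldr₁-composite θ {τ ∷ τs} s (t ∷ ss) =
    ≃-trans (∘-congˡ (foldr₁ _∘_ (τ ∷ τs)) (S⇒poly θ s))
      (≃-trans (poly-∘ (S⇒Letter θ s) (foldr₁ _∘_ (τ ∷ τs)))
        (◃-cong (S⇒Letter θ s) (foldr₁-composite τ t ss)))

  letterwise : ∀ {θs τs} (ss : All.All S θs) (ts : All.All S τs) →
               Pointwise SameLetter (letters ss) (letters ts) → Pointwise _≋_ θs τs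
  letterwise []       []       []        = []
  letterwise {θ ∷ _} {τ ∷ _} (s ∷ ss) (t ∷ ts) (s∼t ∷ p) =
    at (≃-trans (S⇒poly θ s)
      (≃-trans (poly-cong {S⇒Letter θ s} {S⇒Letter τ t} s∼t) (≃-sym (S⇒poly τ t))))
    ∷ letterwise ss ts p

  -- Uniqueness in characteristic zero.

  module _ (char0 : CharacteristicZero K) where

    1≉0 : ¬ (1# ≈ 0#)
    1≉0 e = char0 0 (trans (+-identityʳ 1#) e)

    -- A multiple of `a` is the product of `a` with the same multiple of 1, which is nonzero in
    -- characteristic zero.
    ·-cancelˡ : ∀ k {a b} → suc k · a ≈ suc k · b → a ≈ b
    ·-cancelˡ k {a} {b} e = *-cancelˡ-≉0 (char0 k) (begin
      suc k · 1# * a    ≈⟨ ×-assoc-* (suc k) 1# a ⟩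
      suc k · (1# * a)  ≈⟨ ×-congʳ (suc k) (*-identityˡ a) ⟩
      suc k · a         ≈⟨ e ⟩
      suc k · b         ≈⟨ ×-congʳ (suc k) (*-identityˡ b) ⟨
      suc k · (1# * b)  ≈⟨ ×-assoc-* (suc k) 1# b ⟨
      suc k · 1# * b    ∎)

    ·-nonzero : ∀ k {a} → ¬ (a ≈ 0#) → ¬ (suc k · a ≈ 0#)
    ·-nonzero k a≉0 e = a≉0 (·-cancelˡ k (trans e (sym k·0≈0)))
      where
      k·0≈0 : suc k · 0# ≈ 0#
      k·0≈0 = trans (×-congʳ (suc k) (sym (zeroˡ 0#)))
        (trans (sym (×-assoc-* (suc k) 0# 0#)) (zeroʳ _))

    monic-degree-≮ : ∀ {m n p} → Monic m p → Monic n p → ¬ (m ℕ.< n)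
    monic-degree-≮ {m} {n} {p} M N m<n = 1≉0 (begin
      1#                      ≈⟨ top N 0 ⟨
      coeff p (n ℕ.+ 0)       ≡⟨ ≡.cong (coeff p) (ℕ.+-identityʳ n) ⟩
      coeff p n               ≡⟨ ≡.cong (coeff p) (ℕ.m+[n∸m]≡n m<n) ⟨
      coeff p (suc m ℕ.+ i)   ≡⟨ ≡.cong (coeff p) (ℕ.+-suc m i) ⟨
      coeff p (m ℕ.+ suc i)   ≈⟨ top M (suc i) ⟩
      0#                      ∎)
      where i = n ℕ.∸ suc m

    monic-degree-unique : ∀ {m n p} → Monic m p → Monic n p → m ≡ n
    monic-degree-unique {m} {n} M N with ℕ.<-cmp m n
    ... | tri< m<n _ _ = ⊥-elim (monic-degree-≮ M N m<n)
    ... | tri≈ _ m≡n _ = m≡n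
    ... | tri> _ _ n<m = ⊥-elim (monic-degree-≮ N M n<m)

    -- If d < e, the nonzero second term of p given by L falls strictly between
    -- the two leading terms prescribed by M.
    Leading-gap-≮ : ∀ {d e a b k l p} → ¬ (a ≈ 0#) →
                    Leading (suc d) a k p → Leading (suc e) b l p → ¬ (d ℕ.< e)
    Leading-gap-≮ {d} {e} {a} {b} {k} {l} {p} a≉0 L M d<e = ·-nonzero k a≉0 (begin
      suc k · a                                ≈⟨ z^⊕-0 d (suc k · a) ⟨
      coeff (z^⊕ (suc d) (suc k · a)) 0        ≈⟨ terms L 0 ⟨
      coeff p (k ℕ.* suc d ℕ.+ 0)              ≡⟨ ≡.cong (coeff p) same-index ⟩
      coeff p (l ℕ.* suc e ℕ.+ suc i)          ≈⟨ terms M (suc i) ⟩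
      coeff (z^⊕ (suc e) (suc l · b)) (suc i)  ≈⟨ z^⊕-between (suc l · b) (s≤s i<e) ⟩
      0#                                       ∎)
      where
      -- Put D = d + 1 and E = e + 1. Equality of the degrees kD + D and lE + E gives kD = lE + (E -
      -- D), and E - D is i + 1.
      i = e ℕ.∸ suc d

      d+i≡e : suc d ℕ.+ i ≡ e
      d+i≡e = ℕ.m+[n∸m]≡n d<e

      i<e : i ℕ.< e
      i<e = ≡.subst (suc i ℕ.≤_) d+i≡e (s≤s (ℕ.m≤n+m i d))

      same-index : k ℕ.* suc d ℕ.+ 0 ≡ l ℕ.* suc e ℕ.+ suc i
      same-index = ℕ.+-cancelʳ-≡ (suc d) _ _ (≡.trans
        (≡.cong (ℕ._+ suc d) (ℕ.+-identityʳ (k ℕ.* suc d)))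
        (≡.trans (monic-degree-unique (Leading-monic L) (Leading-monic M))
        (≡.trans (≡.cong (λ m → l ℕ.* suc e ℕ.+ suc m) (≡.sym d+i≡e))
          (solve 3 (λ n i d → n :+ (con 1 :+ (con 1 :+ d :+ i))
                           := n :+ (con 1 :+ i) :+ (con 1 :+ d)) ≡.refl (l ℕ.* suc e) i d))))
        where open +-*-Solver

    -- `Leading-gap-≮` in both directions leaves equal degrees. The degree of `p` then forces k = l,
    -- and the coefficient at the common shift gives equal multiples of `a` and `b`.
    Leading-unique : ∀ {d e a b k l p} → ¬ (a ≈ 0#) → ¬ (b ≈ 0#) →
                     Leading (suc d) a k p → Leading (suc e) b l p → d ≡ e × a ≈ b
    Leading-unique {d} {e} {a} {b} {k} {l} {p} a≉0 b≉0 L M with ℕ.<-cmp d e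
    ... | tri< d<e _ _ = ⊥-elim (Leading-gap-≮ a≉0 L M d<e)
    ... | tri> _ _ e<d = ⊥-elim (Leading-gap-≮ b≉0 M L e<d)
    ... | tri≈ _ ≡.refl _ = ≡.refl , a≈b k≡l
      where
      k≡l : k ≡ l
      k≡l = ℕ.*-cancelʳ-≡ k l (suc d) (ℕ.+-cancelʳ-≡ (suc d) _ _
        (monic-degree-unique (Leading-monic L) (Leading-monic M)))

      a≈b : k ≡ l → a ≈ b
      a≈b ≡.refl = ·-cancelˡ k (begin
        suc k · a                          ≈⟨ z^⊕-0 d (suc k · a) ⟨
        coeff (z^⊕ (suc d) (suc k · a)) 0  ≈⟨ terms L 0 ⟨
        coeff p (k ℕ.* suc d ℕ.+ 0)        ≈⟨ terms M 0 ⟩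
        coeff (z^⊕ (suc d) (suc k · b)) 0  ≈⟨ z^⊕-0 d (suc k · b) ⟩
        suc k · b                          ∎)

    -- The left side has degree at least 2. This rules out that one word is exhausted before the
    -- other.
    composite≄z : ∀ w x → ¬ (composite (w ∷ʳ x) ≃ z)
    composite≄z w x e with Leading-composite w x
    ... | k , L = ℕ.<⇒≢ (ℕ.≤-trans (s≤s (s≤s z≤n)) (ℕ.m≤n+m (degree x) (k ℕ.* degree x)))
      (monic-degree-unique (monic λ _ → refl) (Leading-monic (Leading-resp-≃ e L)))

    -- Innermost letters stand at the end of the list, hence the recursion on reverse views.
    composite-injective : ∀ {w v} → Reverse w → Reverse v →
                          composite w ≃ composite v → Pointwise SameLetter w v
    composite-injective [] [] e = []
    composite-injective [] (v ∶ _ ∶ʳ y) e = ⊥-elim (composite≄z v y (≃-sym e))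
    composite-injective (w ∶ _ ∶ʳ x) [] e = ⊥-elim (composite≄z w x e)
    composite-injective (w ∶ rw ∶ʳ x) (v ∶ rv ∶ʳ y) e
      with Leading-composite w x | Leading-composite v y
    ... | _ , L | _ , M
      with Leading-unique (constant≉0 x) (constant≉0 y) (Leading-resp-≃ e L) M
    ... | d≡e , a≈b = Pointwise.++⁺ (composite-injective rw rv w≃v) (x∼y ∷ [])
      where
      x∼y : SameLetter x y
      x∼y = ≡.cong suc d≡e , a≈b

      -- `poly y` is replaced by the equal `poly x`, so that both sides have the same right factor.
      w∘x≃v∘x : composite w ∘ poly x ≃ composite v ∘ poly x
      w∘x≃v∘x =
        ≃-trans (≃-sym (≃-trans (composite-∷ʳ w x) (foldr-◃ w (poly x))))
          (≃-trans e
            (≃-trans (composite-∷ʳ v y)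
              (≃-trans (≃-sym (foldr-◃-cong v (poly-cong {x} {y} x∼y))) (foldr-◃ v (poly x)))))

      w≃v : composite w ≃ composite v
      w≃v = ∘-cancelʳ (degree-1 x) (composite w) (composite v)
              (z^⊕-monic (degree-1 x) (constant x)) w∘x≃v∘x

    free : FreeOn S
    free (θ ∷ θs) (τ ∷ τs) (s ∷ ss) (t ∷ ts) e =
      letterwise {θ ∷ θs} {τ ∷ τs} (s ∷ ss) (t ∷ ts)
        (composite-injective (reverseView _) (reverseView _)
          (≃-trans (≃-sym (foldr₁-composite θ s ss))
            (≃-trans (pointwise e) (foldr₁-composite τ t ts))))

theorem3p1 : ∀ {c ℓ₁ ℓ₂} (K : HeytingField c ℓ₁ ℓ₂) → CharacteristicZero K →
    let open Polynomials K in FreeOn S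
theorem3p1 K char0 = Words.free K char0
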